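{- Let $q$ be a power of an odd prime $p$ with $q>5$, let $h,k$ be integers with $3\le h\le k$, and let $$D_3=\Bigl\{(x_1,\dots,x_k)\in\mathbb{F}_q^k\setminus\{0\}:\prod_{i=1}^h x_i\prod_{1\le i<j\le h}(x_i+x_j)=0\Bigr\}.$$ Then the minimum nonzero Hamming weight of $\mathrm{C}_{D_3}$ is attained by the codewords corresponding to the hyperplanes $x_i+x_j=0$ ($1\le i<j\le h$) and $x_i=0$ ($1\le i\le h$).
   Context: For a finite list $D$ of points of $\mathbb{F}_q^k$, $\mathrm{C}_D=\{c_a=(a\cdot P)_{P\in D}:a\in\mathbb{F}_q^k\}$; for $a\neq0$ the codeword $c_a$ corresponds to the hyperplane $\{x:a\cdot x=0\}$ through the origin. The weight of $c_a$ is the number of points of $D$ not on that hyperplane. -}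

module Defs where

open import Level using (0ℓ)
open import Data.Nat as ℕ using (ℕ; _<ᵇ_)
open import Data.Fin as Fin using (Fin; toℕ)
open import Data.Bool using (Bool; true; false; not; _∧_; if_then_else_)
open import Data.List using (List; []; _∷_; length; map; concatMap; foldr; allFin; filterᵇ)
open import Data.List.Membership.Propositional using (_∈_)
open import Data.List.Relation.Unary.Unique.Propositional using (Unique)
open import Data.Product using (Σ; _×_; _,_)
open import Relation.Nullary using (¬_; does)
open import Relation.Binary.PropositionalEquality using (_≡_)
open import Relation.Binary.Definitions using (DecidableEquality)
open import Algebra.Structures using (IsCommutativeRing)

record FiniteField : Set₁ where
  infixl 7 _*_
  infixl 6 _+_
  field
    Carrier  : Set
    _+_ _*_  : Carrier → Carrier → Carrier
    -_       : Carrier → Carrier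
    0# 1#    : Carrier
    isCommutativeRing : IsCommutativeRing {A = Carrier} _≡_ _+_ _*_ -_ 0# 1#
    0≢1      : ¬ (0# ≡ 1#)
    inverse  : ∀ x → ¬ (x ≡ 0#) → Σ Carrier (λ y → x * y ≡ 1#)
    _≟_      : DecidableEquality Carrier
    elements : List Carrier
    unique   : Unique elements
    complete : ∀ x → x ∈ elements

module _ (F : FiniteField) where
  open FiniteField F

  order : ℕ
  order = length elements

  Point : ℕ → Set
  Point k = Fin k → Carrier

  isZeroᵇ : Carrier → Bool
  isZeroᵇ x = does (x ≟ 0#)

  dot : ∀ {k} → Point k → Point k → Carrier
  dot {k} a x = foldr (λ i s → a i * x i + s) 0# (allFin k)

  cons : ∀ {k} → Carrier → Point k → Point (ℕ.suc k)
  cons c x Fin.zero    = c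
  cons c x (Fin.suc i) = x i

  allPoints : ∀ k → List (Point k)
  allPoints ℕ.zero    = (λ ()) ∷ []
  allPoints (ℕ.suc k) = concatMap (λ c → map (cons c) (allPoints k)) elements

  isZeroPointᵇ : ∀ {k} → Point k → Bool
  isZeroPointᵇ {k} x = foldr (λ i b → isZeroᵇ (x i) ∧ b) true (allFin k)

  -- indices 1..h (0-based: toℕ i < h), and pairs i < j among them
  firstIdx : ∀ k (h : ℕ) → List (Fin k)
  firstIdx k h = filterᵇ (λ i → toℕ i <ᵇ h) (allFin k)

  pairsIdx : ∀ k (h : ℕ) → List (Fin k × Fin k)
  pairsIdx k h = concatMap (λ i → map (λ j → (i , j))
                   (filterᵇ (λ j → toℕ i <ᵇ toℕ j) (firstIdx k h))) (firstIdx k h)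

  prodF : List Carrier → Carrier
  prodF = foldr _*_ 1#

  polyD3 : ∀ {k} (h : ℕ) → Point k → Carrier
  polyD3 {k} h x = prodF (map x (firstIdx k h))
                 * prodF (map (λ { (i , j) → x i + x j }) (pairsIdx k h))

  inD3ᵇ : ∀ {k} (h : ℕ) → Point k → Bool
  inD3ᵇ h x = not (isZeroPointᵇ x) ∧ isZeroᵇ (polyD3 h x)

  -- Hamming weight of the codeword c_a of C_{D_3}:
  -- number of points of D_3 not on the hyperplane a · x = 0
  weightD3 : ∀ {k} (h : ℕ) → Point k → ℕ
  weightD3 {k} h a = length (filterᵇ (λ x → inD3ᵇ h x ∧ not (isZeroᵇ (dot a x))) (allPoints k))

  -- the vectors e_i and e_i + e_j (normal vectors of x_i = 0 and x_i + x_j = 0)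
  unitVec : ∀ {k} → Fin k → Point k
  unitVec i l = if does (i Fin.≟ l) then 1# else 0#

  pairVec : ∀ {k} → Fin k → Fin k → Point k
  pairVec i j l = unitVec i l + unitVec j l

module Submission where

-- The argument does not depend on the particular shape of D₃.  Let Z ⊆ F^k be
-- any set ("variety") and D = Z ∖ {0}.  For a nonzero vector a write H_a for the
-- hyperplane a·x = 0.  Every point off H_a is nonzero, so
--     #(F^k ∖ H_a) = wt(c_a) + #((F^k ∖ H_a) ∖ Z)   and   #((F^k ∖ H_a) ∖ Z) ≤ #(F^k ∖ Z),
-- with equality in the second relation as soon as H_a ⊆ Z.  All hyperplanes
-- through 0 have q^(k-1) points, so #(F^k ∖ H_a) does not depend on a; hence a
-- hyperplane H_v contained in Z gives a codeword c_v of minimum weight among the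
-- nonzero weights.

open import Defs
open import Data.Nat using (ℕ; suc; _≤_; _<_; _^_)
open import Data.Nat.Primality using (Prime)
open import Data.Nat.Divisibility using (_∣_)
open import Data.Fin using (Fin; toℕ)
open import Data.Product using (Σ; _×_)
open import Relation.Nullary using (¬_)
open import Relation.Binary.PropositionalEquality using (_≡_)

open import Level using (0ℓ)
open import Data.Nat as ℕ using (zero; _<ᵇ_; z≤n; s≤s)
import Data.Nat.Properties as ℕP
open ℕP using (module ≤-Reasoning)
open import Data.Nat.ListAction using (sum)
import Data.Fin as Fin
import Data.Fin.Properties as FinP
open import Data.Bool using (Bool; true; false; not; _∧_; if_then_else_; T; T?)
open import Data.Bool.Properties using (∧-comm; ∧-zeroʳ; T-≡; T-not-≡; T-∧)
open import Data.List using (List; []; _∷_; length; map; concatMap; filterᵇ; _++_; allFin; foldr; tabulate)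
import Data.List.Properties as ListP
open import Data.List.Membership.Propositional using (_∈_)
open import Data.List.Membership.Propositional.Properties using (∈-map⁺; ∈-concat⁺′; ∈-allFin; ∈-filter⁺)
open import Data.List.Relation.Unary.Any as Any using (here; there)
open import Data.List.Relation.Unary.All as All using (All; []; _∷_)
open import Data.List.Relation.Unary.Unique.Propositional using (Unique)
open import Data.List.Relation.Unary.AllPairs using (_∷_)
open import Data.Product using (_,_; proj₁; proj₂)
open import Data.Empty using (⊥-elim)
open import Function using (_∘_; id)
open import Function.Bundles using (Equivalence; mk⇔)
open import Relation.Nullary using (Dec; yes; no; does)
open import Relation.Nullary.Decidable using (dec-true; dec-false; does-⇔)
open import Relation.Binary.PropositionalEquality using (_≢_; _≗_; refl; sym; trans; cong; cong₂; subst; module ≡-Reasoning)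
open import Algebra.Bundles using (CommutativeRing)
open import Algebra.Structures using (IsCommutativeRing)
import Algebra.Properties.Semiring.Sum as SemiringSum
import Algebra.Properties.Group as GroupProperties

module Counting {A : Set} where

  count : (A → Bool) → List A → ℕ
  count p xs = length (filterᵇ p xs)

  count-cong : ∀ {p r : A → Bool} xs → (∀ x → p x ≡ r x) → count p xs ≡ count r xs
  count-cong {p} {r} xs p≗r = cong length (ListP.filter-≐ (T? ∘ p) (T? ∘ r)
    ((λ {x} → subst T (p≗r x)) , (λ {x} → subst T (sym (p≗r x)))) xs)

  count-mono : ∀ {p r : A → Bool} xs → (∀ x → T (p x) → T (r x)) → count p xs ≤ count r xs
  count-mono {p} {r} [] p⇒r = z≤n
  count-mono {p} {r} (x ∷ xs) p⇒r with p x in px | r x in rx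
  ... | false | false = count-mono xs p⇒r
  ... | false | true  = ℕP.m≤n⇒m≤1+n (count-mono xs p⇒r)
  ... | true  | true  = s≤s (count-mono xs p⇒r)
  ... | true  | false = ⊥-elim (subst T rx (p⇒r x (subst T (sym px) _)))

  count-split : ∀ (p r : A → Bool) xs → count p xs ≡ count (λ x → p x ∧ r x) xs ℕ.+ count (λ x → p x ∧ not (r x)) xs
  count-split p r [] = refl
  count-split p r (x ∷ xs) with p x | r x
  ... | false | _     = count-split p r xs
  ... | true  | true  = cong suc (count-split p r xs)
  ... | true  | false = trans (cong suc (count-split p r xs)) (sym (ℕP.+-suc _ _))

  count-complement : ∀ (p : A → Bool) xs → count p xs ℕ.+ count (not ∘ p) xs ≡ length xs
  count-complement p [] = refl
  count-complement p (x ∷ xs) with p x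
  ... | true  = cong suc (count-complement p xs)
  ... | false = trans (ℕP.+-suc _ _) (cong suc (count-complement p xs))

  count-++ : ∀ (p : A → Bool) xs ys → count p (xs ++ ys) ≡ count p xs ℕ.+ count p ys
  count-++ p xs ys = trans (cong length (ListP.filter-++ (T? ∘ p) xs ys)) (ListP.length-++ (filterᵇ p xs))

  count-const : ∀ (b : Bool) xs → count (λ _ → b) xs ≡ (if b then length xs else 0)
  count-const false [] = refl
  count-const true  [] = refl
  count-const false (x ∷ xs) = count-const false xs
  count-const true  (x ∷ xs) = cong suc (count-const true xs)

  count-unique : ∀ (p : A → Bool) {xs} c → Unique xs → c ∈ xs → T (p c) → (∀ x → T (p x) → x ≡ c) → count p xs ≡ 1
  count-unique p c (c∉xs ∷ _) (here refl) pc p⇒c with p c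
  ... | true = cong suc (count-none c∉xs)
    where
    count-none : ∀ {ys} → All (c ≢_) ys → count p ys ≡ 0
    count-none [] = refl
    count-none {y ∷ _} (c≢y ∷ c∉ys) with p y in py
    ... | true  = ⊥-elim (c≢y (sym (p⇒c y (subst T (sym py) _))))
    ... | false = count-none c∉ys
  count-unique p {x ∷ _} c (x∉xs ∷ u) (there c∈xs) pc p⇒c with p x in px
  ... | true  = ⊥-elim (All.lookup x∉xs (subst (_∈ _) (sym (p⇒c x (subst T (sym px) _))) c∈xs) refl)
  ... | false = count-unique p c u c∈xs pc p⇒c

  count-≢0 : ∀ (p : A → Bool) {xs} x → x ∈ xs → T (p x) → count p xs ≢ 0
  count-≢0 p x x∈xs px = ℕP.>⇒≢ (ListP.filter-some (T? ∘ p) (Any.map (λ x≡y → subst (T ∘ p) x≡y px) x∈xs))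

open Counting

count-map : ∀ {A B : Set} (p : B → Bool) (g : A → B) xs → count p (map g xs) ≡ count (p ∘ g) xs
count-map p g [] = refl
count-map p g (y ∷ ys) with p (g y)
... | true  = cong suc (count-map p g ys)
... | false = count-map p g ys

count-concatMap : ∀ {A B : Set} (p : B → Bool) (f : A → List B) xs →
                  count p (concatMap f xs) ≡ sum (map (λ x → count p (f x)) xs)
count-concatMap p f [] = refl
count-concatMap p f (x ∷ xs) = trans (count-++ p (f x) (concatMap f xs)) (cong (count p (f x) ℕ.+_) (count-concatMap p f xs))

sum-cong : ∀ {A : Set} {f g : A → ℕ} xs → (∀ x → f x ≡ g x) → sum (map f xs) ≡ sum (map g xs)
sum-cong xs f≗g = cong sum (ListP.map-cong f≗g xs)

sum-const : ∀ {A : Set} (n : ℕ) (xs : List A) → sum (map (λ _ → n) xs) ≡ length xs ℕ.* n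
sum-const n [] = refl
sum-const n (x ∷ xs) = cong (n ℕ.+_) (sum-const n xs)

sum-if : ∀ {A : Set} (r : A → Bool) (n : ℕ) xs → sum (map (λ x → if r x then n else 0) xs) ≡ count r xs ℕ.* n
sum-if r n [] = refl
sum-if r n (x ∷ xs) with r x
... | true  = cong (n ℕ.+_) (sum-if r n xs)
... | false = sum-if r n xs

decided : ∀ {P : Set} (P? : Dec P) → T (does P?) → P
decided (yes p) _ = p

module Space (F : FiniteField) where
  open FiniteField F
  open IsCommutativeRing isCommutativeRing hiding (refl; sym; trans; _-_; zero)
  open ≡-Reasoning

  ring : CommutativeRing 0ℓ 0ℓ
  ring = record { isCommutativeRing = isCommutativeRing }

  open SemiringSum (CommutativeRing.semiring ring) using (sum-syntax; ∑-distrib-+; sum-cong-≗; sum-replicate-zero)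
  open GroupProperties (CommutativeRing.+-group ring) using (y≈x\\z; \\-leftDividesˡ)

  q : ℕ
  q = order F

  IsNonzero : ∀ {k} → Point F k → Set
  IsNonzero a = ¬ (∀ i → a i ≡ 0#)

  T-isZero : ∀ {d} → d ≡ 0# → T (isZeroᵇ F d)
  T-isZero {d} d≡0 = Equivalence.from T-≡ (dec-true (d ≟ 0#) d≡0)

  ∑-zero : ∀ {n} (G : Fin n → Carrier) → (∀ i → G i ≡ 0#) → ∑[ i < n ] G i ≡ 0#
  ∑-zero {n} G G≡0 = trans (sum-cong-≗ G≡0) (sum-replicate-zero n)

  ∑-single : ∀ {n} (G : Fin n → Carrier) i → (∀ l → l ≢ i → G l ≡ 0#) → ∑[ l < n ] G l ≡ G i
  ∑-single {suc n} G Fin.zero G≡0 =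
    trans (cong (G Fin.zero +_) (∑-zero (G ∘ Fin.suc) (λ l → G≡0 (Fin.suc l) (λ ())))) (+-identityʳ _)
  ∑-single {suc n} G (Fin.suc i) G≡0 =
    trans (cong₂ _+_ (G≡0 Fin.zero (λ ())) (∑-single (G ∘ Fin.suc) i (λ l l≢i → G≡0 (Fin.suc l) (l≢i ∘ FinP.suc-injective))))
          (+-identityˡ _)

  dot≡∑ : ∀ {k} (a x : Point F k) → dot F a x ≡ ∑[ i < k ] (a i * x i)
  dot≡∑ {k} a x = foldr-tabulate id
    where
    foldr-tabulate : ∀ {n} (f : Fin n → Fin k) →
                     foldr (λ i s → a i * x i + s) 0# (tabulate f) ≡ ∑[ l < n ] (a (f l) * x (f l))
    foldr-tabulate {zero}  f = refl
    foldr-tabulate {suc n} f = cong (a (f Fin.zero) * x (f Fin.zero) +_) (foldr-tabulate (f ∘ Fin.suc))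

  dot-cons : ∀ {k} (a : Point F (suc k)) c (x : Point F k) →
             dot F a (cons F c x) ≡ a Fin.zero * c + dot F (a ∘ Fin.suc) x
  dot-cons a c x = trans (dot≡∑ a (cons F c x)) (cong (a Fin.zero * c +_) (sym (dot≡∑ (a ∘ Fin.suc) x)))

  dot-cong : ∀ {k} (a : Point F k) {x y : Point F k} → x ≗ y → dot F a x ≡ dot F a y
  dot-cong a {x} {y} x≗y = begin
    dot F a x               ≡⟨ dot≡∑ a x ⟩
    ∑[ i < _ ] (a i * x i)  ≡⟨ sum-cong-≗ (λ i → cong (a i *_) (x≗y i)) ⟩
    ∑[ i < _ ] (a i * y i)  ≡⟨ dot≡∑ a y ⟨
    dot F a y               ∎

  dot-zeroˡ : ∀ {k} (a x : Point F k) → (∀ i → a i ≡ 0#) → dot F a x ≡ 0#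
  dot-zeroˡ a x a≡0 = trans (dot≡∑ a x) (∑-zero _ (λ i → trans (cong (_* x i) (a≡0 i)) (zeroˡ (x i))))

  dot-zeroʳ : ∀ {k} (a x : Point F k) → (∀ i → x i ≡ 0#) → dot F a x ≡ 0#
  dot-zeroʳ a x x≡0 = trans (dot≡∑ a x) (∑-zero _ (λ i → trans (cong (a i *_) (x≡0 i)) (zeroʳ (a i))))

  dot-linearˡ : ∀ {k} (a b x : Point F k) → dot F (λ l → a l + b l) x ≡ dot F a x + dot F b x
  dot-linearˡ a b x = begin
    dot F (λ l → a l + b l) x                       ≡⟨ dot≡∑ _ x ⟩
    ∑[ l < _ ] ((a l + b l) * x l)                  ≡⟨ sum-cong-≗ (λ l → distribʳ (x l) (a l) (b l)) ⟩
    ∑[ l < _ ] (a l * x l + b l * x l)              ≡⟨ ∑-distrib-+ (λ l → a l * x l) (λ l → b l * x l) ⟩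
    ∑[ l < _ ] (a l * x l) + ∑[ l < _ ] (b l * x l) ≡⟨ cong₂ _+_ (dot≡∑ a x) (dot≡∑ b x) ⟨
    dot F a x + dot F b x                           ∎

  unitVec-same : ∀ {k} (i : Fin k) → unitVec F i i ≡ 1#
  unitVec-same i with i Fin.≟ i
  ... | yes _   = refl
  ... | no i≢i = ⊥-elim (i≢i refl)

  unitVec-other : ∀ {k} (i l : Fin k) → l ≢ i → unitVec F i l ≡ 0#
  unitVec-other i l l≢i with i Fin.≟ l
  ... | yes i≡l = ⊥-elim (l≢i (sym i≡l))
  ... | no _    = refl

  dot-unit : ∀ {k} (i : Fin k) (x : Point F k) → dot F (unitVec F i) x ≡ x i
  dot-unit i x = begin
    dot F (unitVec F i) x           ≡⟨ dot≡∑ (unitVec F i) x ⟩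
    ∑[ l < _ ] (unitVec F i l * x l) ≡⟨ ∑-single _ i (λ l l≢i → trans (cong (_* x l) (unitVec-other i l l≢i)) (zeroˡ (x l))) ⟩
    unitVec F i i * x i             ≡⟨ cong (_* x i) (unitVec-same i) ⟩
    1# * x i                        ≡⟨ *-identityˡ (x i) ⟩
    x i                             ∎

  dot-pair : ∀ {k} (i j : Fin k) (x : Point F k) → dot F (pairVec F i j) x ≡ x i + x j
  dot-pair i j x = trans (dot-linearˡ (unitVec F i) (unitVec F j) x) (cong₂ _+_ (dot-unit i x) (dot-unit j x))

  isZeroPoint-sound : ∀ {k} (x : Point F k) → T (isZeroPointᵇ F x) → ∀ i → x i ≡ 0#
  isZeroPoint-sound {k} x zero? i = zero-on (allFin k) zero? (∈-allFin i)
    where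
    zero-on : ∀ is → T (foldr (λ i b → isZeroᵇ F (x i) ∧ b) true is) → ∀ {i} → i ∈ is → x i ≡ 0#
    zero-on (j ∷ is) t (here refl) = decided (x j ≟ 0#) (proj₁ (Equivalence.to T-∧ t))
    zero-on (j ∷ is) t (there i∈is) = zero-on is (proj₂ (Equivalence.to T-∧ t)) i∈is

  allPoints-complete : ∀ k (x : Point F k) → Σ (Point F k) (λ y → y ∈ allPoints F k × y ≗ x)
  allPoints-complete zero x = _ , here refl , (λ ())
  allPoints-complete (suc k) x with allPoints-complete k (x ∘ Fin.suc)
  ... | y , y∈ , y≗x =
    cons F (x Fin.zero) y ,
    ∈-concat⁺′ (∈-map⁺ (cons F (x Fin.zero)) y∈) (∈-map⁺ (λ c → map (cons F c) (allPoints F k)) (complete (x Fin.zero))) ,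
    λ { Fin.zero → refl ; (Fin.suc i) → y≗x i }

  count-allPoints-suc : ∀ k (p : Point F (suc k) → Bool) →
                        count p (allPoints F (suc k)) ≡ sum (map (λ c → count (p ∘ cons F c) (allPoints F k)) elements)
  count-allPoints-suc k p = trans (count-concatMap p (λ c → map (cons F c) (allPoints F k)) elements)
                                  (sum-cong elements (λ c → count-map p (cons F c) (allPoints F k)))

  length-allPoints : ∀ k → length (allPoints F k) ≡ q ^ k
  length-allPoints zero = refl
  length-allPoints (suc k) = begin
    length (allPoints F (suc k))                  ≡⟨ count-const true (allPoints F (suc k)) ⟨
    count (λ _ → true) (allPoints F (suc k))      ≡⟨ count-allPoints-suc k (λ _ → true) ⟩
    sum (map (λ c → count (λ _ → true) (allPoints F k)) elements)
      ≡⟨ sum-cong elements (λ _ → trans (count-const true (allPoints F k)) (length-allPoints k)) ⟩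
    sum (map (λ _ → q ^ k) elements)               ≡⟨ sum-const (q ^ k) elements ⟩
    q ℕ.* q ^ k                                    ∎

  level : ∀ {k} → Point F k → Carrier → ℕ
  level {k} a t = count (λ x → does (dot F a x ≟ t)) (allPoints F k)

  unique-solution : ∀ a₀ → a₀ ≢ 0# → ∀ t → count (λ c → does ((a₀ * c) ≟ t)) elements ≡ 1
  unique-solution a₀ a₀≢0 t = count-unique _ (b * t) unique (complete (b * t)) solves only
    where
    b : Carrier
    b = proj₁ (inverse a₀ a₀≢0)
    a₀b≡1 : a₀ * b ≡ 1#
    a₀b≡1 = proj₂ (inverse a₀ a₀≢0)
    solves : T (does ((a₀ * (b * t)) ≟ t))
    solves = Equivalence.from T-≡ (dec-true ((a₀ * (b * t)) ≟ t)
               (trans (sym (*-assoc a₀ b t)) (trans (cong (_* t) a₀b≡1) (*-identityˡ t))))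
    only : ∀ c → T (does ((a₀ * c) ≟ t)) → c ≡ b * t
    only c sol = begin
      c              ≡⟨ *-identityˡ c ⟨
      1# * c         ≡⟨ cong (_* c) (trans (*-comm b a₀) a₀b≡1) ⟨
      (b * a₀) * c   ≡⟨ *-assoc b a₀ c ⟩
      b * (a₀ * c)   ≡⟨ cong (b *_) (decided ((a₀ * c) ≟ t) sol) ⟩
      b * t          ∎

  solve-summand : ∀ u d t → does ((u + d) ≟ t) ≡ does (d ≟ (- u + t))
  solve-summand u d t = does-⇔
    (mk⇔ (y≈x\\z u d t) (λ d≡ → subst (λ d → u + d ≡ t) (sym d≡) (\\-leftDividesˡ u t)))
    ((u + d) ≟ t) (d ≟ (- u + t))

  level-by-first : ∀ {k} (a : Point F (suc k)) t →
                   level a t ≡ sum (map (λ c → count (λ x → does ((a Fin.zero * c + dot F (a ∘ Fin.suc) x) ≟ t)) (allPoints F k)) elements)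
  level-by-first {k} a t = trans (count-allPoints-suc k _)
    (sum-cong elements (λ c → count-cong (allPoints F k) (λ x → cong (λ d → does (d ≟ t)) (dot-cons a c x))))

  -- if only the first coordinate of a is nonzero, a · x = t fixes x₀ and leaves x' free
  level-size-axis : ∀ m (a : Point F (suc m)) → (∀ i → a (Fin.suc i) ≡ 0#) → IsNonzero a → ∀ t → level a t ≡ q ^ m
  level-size-axis m a a'≡0 a≢0 t = begin
    level a t ≡⟨ level-by-first a t ⟩
    sum (map (λ c → count (λ x → does ((a₀ * c + dot F a' x) ≟ t)) L) elements)
      ≡⟨ sum-cong elements (λ c → trans (count-cong L (λ x → cong (λ d → does (d ≟ t)) (fibre-value c x)))
                                        (count-const (does ((a₀ * c) ≟ t)) L)) ⟩
    sum (map (λ c → if does ((a₀ * c) ≟ t) then length L else 0) elements)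
      ≡⟨ sum-if (λ c → does ((a₀ * c) ≟ t)) (length L) elements ⟩
    count (λ c → does ((a₀ * c) ≟ t)) elements ℕ.* length L
      ≡⟨ cong₂ ℕ._*_ (unique-solution a₀ a₀≢0 t) (length-allPoints m) ⟩
    1 ℕ.* q ^ m ≡⟨ ℕP.*-identityˡ (q ^ m) ⟩
    q ^ m ∎
    where
    a₀ : Carrier
    a₀ = a Fin.zero
    a' : Point F m
    a' = a ∘ Fin.suc
    L : List (Point F m)
    L = allPoints F m
    a₀≢0 : a₀ ≢ 0#
    a₀≢0 a₀≡0 = a≢0 (λ { Fin.zero → a₀≡0 ; (Fin.suc i) → a'≡0 i })
    fibre-value : ∀ c x → a₀ * c + dot F a' x ≡ a₀ * c
    fibre-value c x = trans (cong (a₀ * c +_) (dot-zeroˡ a' x a'≡0)) (+-identityʳ _)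

  -- every affine hyperplane a · x = t (a ≠ 0) of F^(m+1) has q^m points; by induction
  -- on m: when the tail a' of a is nonzero, each fibre over x₀ = c is the affine
  -- hyperplane a' · x' = t - a₀ c of F^m
  level-size : ∀ m (a : Point F (suc m)) → IsNonzero a → ∀ t → level a t ≡ q ^ m
  level-size zero a a≢0 t = level-size-axis zero a (λ ()) a≢0 t
  level-size (suc m) a a≢0 t with FinP.all? (λ i → a (Fin.suc i) ≟ 0#)
  ... | yes a'≡0 = level-size-axis (suc m) a a'≡0 a≢0 t
  ... | no  a'≢0 = begin
    level a t ≡⟨ level-by-first a t ⟩
    sum (map (λ c → count (λ x → does ((a₀ * c + dot F a' x) ≟ t)) (allPoints F (suc m))) elements)
      ≡⟨ sum-cong elements (λ c → trans (count-cong (allPoints F (suc m)) (λ x → solve-summand (a₀ * c) (dot F a' x) t))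
                                        (level-size m a' a'≢0 ((- (a₀ * c)) + t))) ⟩
    sum (map (λ _ → q ^ m) elements) ≡⟨ sum-const (q ^ m) elements ⟩
    q ℕ.* q ^ m ∎
    where
    a₀ : Carrier
    a₀ = a Fin.zero
    a' : Point F (suc m)
    a' = a ∘ Fin.suc

  off : ∀ {k} → Point F k → Point F k → Bool
  off a x = not (isZeroᵇ F (dot F a x))

  off-count-invariant : ∀ {k} (a b : Point F k) → IsNonzero a → IsNonzero b →
                        count (off a) (allPoints F k) ≡ count (off b) (allPoints F k)
  off-count-invariant {zero}  a b a≢0 _ = ⊥-elim (a≢0 (λ ()))
  off-count-invariant {suc m} a b a≢0 b≢0 = ℕP.+-cancelˡ-≡ (q ^ m) _ _ (begin
    q ^ m ℕ.+ count (off a) L   ≡⟨ cong (ℕ._+ count (off a) L) (level-size m a a≢0 0#) ⟨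
    level a 0# ℕ.+ count (off a) L ≡⟨ count-complement _ L ⟩
    length L                       ≡⟨ count-complement _ L ⟨
    level b 0# ℕ.+ count (off b) L ≡⟨ cong (ℕ._+ count (off b) L) (level-size m b b≢0 0#) ⟩
    q ^ m ℕ.+ count (off b) L   ∎)
    where
    L : List (Point F (suc m))
    L = allPoints F (suc m)

module Weight (F : FiniteField) {k : ℕ} (Z : Point F k → Bool) where
  open FiniteField F
  open Space F
  open ≤-Reasoning

  inD : Point F k → Bool
  inD x = not (isZeroPointᵇ F x) ∧ Z x

  weight : Point F k → ℕ
  weight a = count (λ x → inD x ∧ off a x) (allPoints F k)

  HasMinimumWeight : Point F k → Set
  HasMinimumWeight v = weight v ≢ 0 × (∀ (a : Point F k) → weight a ≢ 0 → weight v ≤ weight a)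

  off⇒nonzero : ∀ (a x : Point F k) → T (off a x) → isZeroPointᵇ F x ≡ false
  off⇒nonzero a x off-ax with isZeroPointᵇ F x in x≡0?
  ... | false = refl
  ... | true  = ⊥-elim (subst (T ∘ not) (dec-true (dot F a x ≟ 0#) dot≡0) off-ax)
    where
    dot≡0 : dot F a x ≡ 0#
    dot≡0 = dot-zeroʳ a x (isZeroPoint-sound x (subst T (sym x≡0?) _))

  off-decomposition : ∀ (a : Point F k) → count (off a) (allPoints F k) ≡ weight a ℕ.+ count (λ x → off a x ∧ not (Z x)) (allPoints F k)
  off-decomposition a = trans (count-split (off a) inD (allPoints F k))
    (cong₂ ℕ._+_ (count-cong (allPoints F k) (λ x → ∧-comm (off a x) (inD x)))
                 (count-cong (allPoints F k) outside-D))
    where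
    outside-D : ∀ x → off a x ∧ not (inD x) ≡ off a x ∧ not (Z x)
    outside-D x with off a x in off-ax
    ... | false = refl
    ... | true  = cong (λ b → not (not b ∧ Z x)) (off⇒nonzero a x (subst T (sym off-ax) _))

  outside-Z-bound : ∀ (a : Point F k) → count (λ x → off a x ∧ not (Z x)) (allPoints F k) ≤ count (not ∘ Z) (allPoints F k)
  outside-Z-bound a = count-mono (allPoints F k) (λ x → proj₂ ∘ Equivalence.to T-∧)

  outside-Z-exact : ∀ (v : Point F k) → (∀ x → dot F v x ≡ 0# → T (Z x)) →
                    count (λ x → off v x ∧ not (Z x)) (allPoints F k) ≡ count (not ∘ Z) (allPoints F k)
  outside-Z-exact v H⊆Z = count-cong (allPoints F k) pointwise
    where
    pointwise : ∀ x → off v x ∧ not (Z x) ≡ not (Z x)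
    pointwise x with Z x in Zx
    ... | true  = ∧-zeroʳ (off v x)
    ... | false = cong (λ b → not b ∧ true) (dec-false (dot F v x ≟ 0#) (λ v·x≡0 → subst T Zx (H⊆Z x v·x≡0)))

  weight≢0⇒nonzero : ∀ (a : Point F k) → weight a ≢ 0 → IsNonzero a
  weight≢0⇒nonzero a wt≢0 a≡0 = wt≢0 (trans
    (count-cong (allPoints F k) (λ x → trans (cong (λ b → inD x ∧ not b) (dec-true (dot F a x ≟ 0#) (dot-zeroˡ a x a≡0)))
                                             (∧-zeroʳ (inD x))))
    (count-const false (allPoints F k)))

  hyperplane-in-Z-minimal : ∀ (v : Point F k) → weight v ≢ 0 → (∀ x → dot F v x ≡ 0# → T (Z x)) →
                            ∀ (a : Point F k) → weight a ≢ 0 → weight v ≤ weight a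
  hyperplane-in-Z-minimal v wt-v≢0 H⊆Z a wt-a≢0 = ℕP.+-cancelʳ-≤ X (weight v) (weight a) (begin
    weight v ℕ.+ X                                         ≡⟨ cong (weight v ℕ.+_) (outside-Z-exact v H⊆Z) ⟨
    weight v ℕ.+ count (λ x → off v x ∧ not (Z x)) L      ≡⟨ off-decomposition v ⟨
    count (off v) L                                        ≡⟨ off-count-invariant v a (weight≢0⇒nonzero v wt-v≢0) (weight≢0⇒nonzero a wt-a≢0) ⟩
    count (off a) L                                        ≡⟨ off-decomposition a ⟩
    weight a ℕ.+ count (λ x → off a x ∧ not (Z x)) L      ≤⟨ ℕP.+-monoʳ-≤ (weight a) (outside-Z-bound a) ⟩
    weight a ℕ.+ X                                         ∎)
    where
    L : List (Point F k)
    L = allPoints F k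
    X : ℕ
    X = count (not ∘ Z) L

  weight-witness : ∀ (v x : Point F k) → (∀ y → y ≗ x → T (Z y)) → dot F v x ≢ 0# → weight v ≢ 0
  weight-witness v x Z-near-x v·x≢0 with allPoints-complete k x
  ... | y , y∈ , y≗x = count-≢0 _ y y∈ (Equivalence.from T-∧ (in-D , off-vy))
    where
    off-vy : T (off v y)
    off-vy = Equivalence.from T-not-≡ (dec-false (dot F v y ≟ 0#) (v·x≢0 ∘ trans (sym (dot-cong v y≗x))))
    in-D : T (inD y)
    in-D = Equivalence.from T-∧ (Equivalence.from T-not-≡ (off⇒nonzero v y off-vy) , Z-near-x y y≗x)

  minimum-weight : ∀ (v : Point F k) → (∀ x → dot F v x ≡ 0# → T (Z x)) →
                   (x : Point F k) → (∀ y → y ≗ x → T (Z y)) → dot F v x ≢ 0# → HasMinimumWeight v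
  minimum-weight v H⊆Z x Z-near-x v·x≢0 = wt≢0 , hyperplane-in-Z-minimal v wt≢0 H⊆Z
    where
    wt≢0 : weight v ≢ 0
    wt≢0 = weight-witness v x Z-near-x v·x≢0

index-besides : ∀ {n} → 2 ≤ n → (i : Fin n) → Σ (Fin n) (λ l → l ≢ i × toℕ l < 2)
index-besides (s≤s (s≤s z≤n)) Fin.zero    = Fin.suc Fin.zero , (λ ()) , s≤s (s≤s z≤n)
index-besides (s≤s (s≤s z≤n)) (Fin.suc i) = Fin.zero , (λ ()) , s≤s z≤n

module D3 (F : FiniteField) (h : ℕ) {k : ℕ} where
  open FiniteField F
  open IsCommutativeRing isCommutativeRing using (zeroˡ; zeroʳ; +-identityʳ)
  open Space F

  Z₃ : Point F k → Bool
  Z₃ x = isZeroᵇ F (polyD3 F h x)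

  open Weight F Z₃

  zero-factorˡ : ∀ {u w} → u ≡ 0# → u * w ≡ 0#
  zero-factorˡ {u} {w} u≡0 = trans (cong (_* w) u≡0) (zeroˡ w)

  zero-factorʳ : ∀ {u w} → w ≡ 0# → u * w ≡ 0#
  zero-factorʳ {u} {w} w≡0 = trans (cong (u *_) w≡0) (zeroʳ u)

  prodF-zero : ∀ {z} xs → z ∈ xs → z ≡ 0# → prodF F xs ≡ 0#
  prodF-zero (y ∷ ys) (here refl) z≡0  = zero-factorˡ z≡0
  prodF-zero (y ∷ ys) (there z∈ys) z≡0 = zero-factorʳ (prodF-zero ys z∈ys z≡0)

  firstIdx-mem : ∀ (i : Fin k) → toℕ i < h → i ∈ firstIdx F k h
  firstIdx-mem i i<h = ∈-filter⁺ (λ j → T? (toℕ j <ᵇ h)) (∈-allFin i) (ℕP.<⇒<ᵇ i<h)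

  pairsIdx-mem : ∀ (i j : Fin k) → toℕ i < toℕ j → toℕ j < h → (i , j) ∈ pairsIdx F k h
  pairsIdx-mem i j i<j j<h =
    ∈-concat⁺′ (∈-map⁺ (i ,_) (∈-filter⁺ (λ j → T? (toℕ i <ᵇ toℕ j)) (firstIdx-mem j j<h) (ℕP.<⇒<ᵇ i<j)))
               (∈-map⁺ (λ i → map (i ,_) (filterᵇ (λ j → toℕ i <ᵇ toℕ j) (firstIdx F k h)))
                       (firstIdx-mem i (ℕP.<-trans i<j j<h)))

  vanishes-on-axis : ∀ (i : Fin k) (x : Point F k) → toℕ i < h → x i ≡ 0# → T (Z₃ x)
  vanishes-on-axis i x i<h xᵢ≡0 = T-isZero (zero-factorˡ (prodF-zero _ (∈-map⁺ x (firstIdx-mem i i<h)) xᵢ≡0))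

  vanishes-on-pair : ∀ (i j : Fin k) (x : Point F k) → toℕ i < toℕ j → toℕ j < h → x i + x j ≡ 0# → T (Z₃ x)
  vanishes-on-pair i j x i<j j<h xᵢ+xⱼ≡0 = T-isZero (zero-factorʳ (prodF-zero _ (∈-map⁺ _ (pairsIdx-mem i j i<j j<h)) xᵢ+xⱼ≡0))

  another-index : 2 ≤ h → h ≤ k → (i : Fin k) → Σ (Fin k) (λ l → l ≢ i × toℕ l < h)
  another-index 2≤h h≤k i with index-besides (ℕP.≤-trans 2≤h h≤k) i
  ... | l , l≢i , l<2 = l , l≢i , ℕP.<-≤-trans l<2 2≤h

  -- the hyperplane x_i = 0 lies in Z₃, and e_i (which has x_l = 0 for another
  -- index l ≤ h) is a point of D₃ off it
  axis-minimal : 2 ≤ h → h ≤ k → ∀ (i : Fin k) → toℕ i < h → HasMinimumWeight (unitVec F i)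
  axis-minimal 2≤h h≤k i i<h with another-index 2≤h h≤k i
  ... | l , l≢i , l<h = minimum-weight (unitVec F i)
    (λ x eᵢ·x≡0 → vanishes-on-axis i x i<h (trans (sym (dot-unit i x)) eᵢ·x≡0))
    (unitVec F i)
    (λ y y≗eᵢ → vanishes-on-axis l y l<h (trans (y≗eᵢ l) (unitVec-other i l l≢i)))
    (λ eᵢ·eᵢ≡0 → 0≢1 (trans (sym eᵢ·eᵢ≡0) (trans (dot-unit i (unitVec F i)) (unitVec-same i))))

  -- the hyperplane x_i + x_j = 0 lies in Z₃, and e_i (with x_j = 0) is a point
  -- of D₃ off it
  pair-minimal : ∀ (i j : Fin k) → toℕ i < toℕ j → toℕ j < h → HasMinimumWeight (pairVec F i j)
  pair-minimal i j i<j j<h = minimum-weight (pairVec F i j)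
    (λ x v·x≡0 → vanishes-on-pair i j x i<j j<h (trans (sym (dot-pair i j x)) v·x≡0))
    (unitVec F i)
    (λ y y≗eᵢ → vanishes-on-axis j y j<h (eᵢ-vanishes-at-j y y≗eᵢ))
    (λ v·eᵢ≡0 → 0≢1 (trans (sym v·eᵢ≡0) (begin
      dot F (pairVec F i j) (unitVec F i) ≡⟨ dot-pair i j (unitVec F i) ⟩
      unitVec F i i + unitVec F i j       ≡⟨ cong₂ _+_ (unitVec-same i) (unitVec-other i j j≢i) ⟩
      1# + 0#                             ≡⟨ +-identityʳ 1# ⟩
      1#                                  ∎)))
    where
    open ≡-Reasoning
    j≢i : j ≢ i
    j≢i j≡i = ℕP.<-irrefl (cong toℕ (sym j≡i)) i<j
    eᵢ-vanishes-at-j : ∀ y → y ≗ unitVec F i → y j ≡ 0#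
    eᵢ-vanishes-at-j y y≗eᵢ = trans (y≗eᵢ j) (unitVec-other i j j≢i)

-- weightD3 F h is, by definition, the weight for Z = Z₃.  Only h ≥ 2 (and h ≤ k)
-- is used: the minimality holds over every finite field.
proposition12 : (F : FiniteField) (p n : ℕ) → Prime p → ¬ (2 ∣ p) → order F ≡ p ^ suc n → 5 < order F →
    (h k : ℕ) → 3 ≤ h → h ≤ k →
    -- each codeword for x_i = 0 (1 ≤ i ≤ h) has minimum nonzero weight
    (∀ (i : Fin k) → toℕ i < h →
      ¬ (weightD3 F h (unitVec F i) ≡ 0) ×
      (∀ (a : Point F k) → ¬ (weightD3 F h a ≡ 0) → weightD3 F h (unitVec F i) ≤ weightD3 F h a)) ×
    -- each codeword for x_i + x_j = 0 (1 ≤ i < j ≤ h) has minimum nonzero weight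
    (∀ (i j : Fin k) → toℕ i < toℕ j → toℕ j < h →
      ¬ (weightD3 F h (pairVec F i j) ≡ 0) ×
      (∀ (a : Point F k) → ¬ (weightD3 F h a ≡ 0) → weightD3 F h (pairVec F i j) ≤ weightD3 F h a))
proposition12 F _ _ _ _ _ _ h k 3≤h h≤k =
  axis-minimal (ℕP.≤-trans (ℕP.n≤1+n 2) 3≤h) h≤k , pair-minimal
  where open D3 F h {k}
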